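{- Let $\mathcal{P}$ be an $\ell$-dimensional LR-vine and let $(G,\lambda)=\Omega(\mathcal{P})$. If $(v_1,\dots,v_\ell)$ is an MAT-PEO of $(G,\lambda)$, then $(v_1,\dots,v_\ell)$ is a sampling order of $\mathcal{P}$. As a consequence, every LR-vine has a sampling order.
   Context: Posets are finite. A graded poset has a rank function $\operatorname{rk}\colon\mathcal{P}\to\mathbb{Z}_{>0}$ with $x<y\Rightarrow\operatorname{rk}(x)<\operatorname{rk}(y)$, $\operatorname{rk}(y)=\operatorname{rk}(x)+1$ when $y$ covers $x$, and all minimal elements of rank $1$; $\mathcal{P}_i$ = elements of rank $i$, $\dim(\mathcal{P})$ = number of minimal elements, $\mathcal{E}(v)$ = elements covered by $v$. A vine is a graded poset in which every non-minimal element covers exactly two elements, any two distinct elements of the same rank are covered by at most one common element, and for each $1\le i\le\operatorname{rk}(\mathcal{P})$ the graph $F_i$ on $\mathcal{P}_i$ with edge set $\{\mathcal{E}(v)\mid v\in\mathcal{P}_{i+1}\}$ is a forest. An R-vine is a vine with $\operatorname{rk}(\mathcal{P})=\dim(\mathcal{P})$, each $F_i$ a tree, and proximity: distinct elements of the same rank $i\ge2$ covered by a common element cover a common element. An LR-vine is a vine all of whose principal ideals $\mathcal{P}_{\le v}$ (induced order and rank) are R-vines. For $v\in\mathcal{P}$, $U_v$ = set of minimal elements $\le v$; for non-minimal $v$ covering $a,b$, its conditioned set is $C_v=U_a\triangle U_b$. $\Omega(\mathcal{P})$ is the edge-labeled graph $(G,\lambda)$ with vertex set the minimal elements of $\mathcal{P}$,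 where $\{i,j\}$ ($i\ne j$) is an edge iff the join $i\vee j$ exists in $\mathcal{P}$, with label $\lambda(i,j)=\operatorname{rk}(i\vee j)-1$. For an edge-labeled graph $(G,\lambda)$, a vertex $v$ is MAT-simplicial if (MS1) its neighborhood is a clique; (MS2) the labels of edges incident to $v$ are exactly $\{1,2,\dots,\deg_G(v)\}$; (MS3) for distinct neighbors $u_1,u_2$ of $v$, $\lambda(u_1,u_2)<\max\{\lambda(u_1,v),\lambda(u_2,v)\}$. An ordering $(v_1,\dots,v_\ell)$ of the vertices is an MAT-PEO if for each $i$, $v_i$ is MAT-simplicial in $(G_i,\lambda_i)$, where $G_i=G[\{v_1,\dots,v_i\}]$ is the induced subgraph and $\lambda_i=\lambda|_{E_{G_i}}$. For a minimal element $v$ of an LR-vine $\mathcal{P}$, the marginalization $\mathcal{P}\,\|\,v$ is the induced subposet $\mathcal{P}\setminus(\{v\}\cup\{x\in\mathcal{P}\mid v\in C_x\})$. An induced subposet $\mathcal{Q}$ is graded by $\operatorname{rk}_{\mathcal{P}}$ if $\operatorname{rk}_{\mathcal{P}}|_{\mathcal{Q}}$ is a rank function on $\mathcal{Q}$. An ordering $(v_1,\dots,v_\ell)$ of the minimal elements of an $\ell$-dimensional LR-vine $\mathcal{P}$ is a sampling order if, with $\mathcal{P}_\ell:=\mathcal{P}$ and $\mathcal{P}_i:=\mathcal{P}_{i+1}\,\|\,v_{i+1}$, each $\mathcal{P}_i$ ($1\le i\le\ell-1$) is an LR-vine graded by $\operatorname{rk}_{\mathcal{P}}$. -}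

module Defs where

open import Data.Nat using (ℕ; zero; suc; _≤_; _<_; _⊔_; _+_)
open import Data.Fin using (Fin; toℕ)
open import Data.Product using (Σ; ∃; _×_; _,_)
open import Data.Sum using (_⊎_)
open import Data.List using (List; []; _∷_; length; _++_; take; drop; lookup)
open import Data.List.Membership.Propositional using (_∈_)
open import Data.List.Relation.Unary.Unique.Propositional using (Unique)
open import Data.List.Relation.Unary.All using (All)
open import Data.List.Relation.Unary.Linked using (Linked)
open import Relation.Binary.Construct.Closure.ReflexiveTransitive using (Star)
open import Relation.Binary.Core using (Rel)
open import Relation.Binary.Definitions using (Decidable)
open import Relation.Binary.Structures using (IsPartialOrder)
open import Relation.Binary.PropositionalEquality using (_≡_; _≢_)
open import Relation.Nullary using (¬_)
open import Function.Bundles using (_⇔_)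
open import Data.Unit using (⊤)

record FinPoset (n : ℕ) : Set₁ where
  field
    _⊑_            : Fin n → Fin n → Set
    isPartialOrder : IsPartialOrder _≡_ _⊑_
    _⊑?_           : Decidable _⊑_

-- Subsets of the carrier; an induced subposet is given by such a subset
-- (with the order of the ambient poset restricted to it).
Sub : ℕ → Set₁
Sub n = Fin n → Set

Card : ∀ {n} → Sub n → ℕ → Set
Card {n} S d = Σ (List (Fin n)) λ xs →
  Unique xs × (∀ x → (x ∈ xs) ⇔ S x) × length xs ≡ d

IsOrdering : ∀ {n} → Sub n → List (Fin n) → Set
IsOrdering S vs = Unique vs × (∀ x → (x ∈ vs) ⇔ S x)

module _ {n : ℕ} (P : FinPoset n) where
  open FinPoset P

  Covers : Sub n → Fin n → Fin n → Set
  Covers X y x = X x × X y × x ⊑ y × x ≢ y ×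
    (∀ z → X z → x ⊑ z → z ⊑ y → (z ≡ x) ⊎ (z ≡ y))

  Minimal : Sub n → Fin n → Set
  Minimal X x = X x × (∀ y → X y → y ⊑ x → y ≡ x)

  -- rk is a rank function on the induced subposet X (values in ℤ_{>0},
  -- represented in ℕ; positivity follows from the minimal-elements clause)
  IsRank : Sub n → (Fin n → ℕ) → Set
  IsRank X rk =
    (∀ x y → X x → X y → x ⊑ y → x ≢ y → rk x < rk y) ×
    (∀ x y → Covers X y x → rk y ≡ suc (rk x)) ×
    (∀ x → Minimal X x → rk x ≡ 1)

  -- rk(P) = r : the maximum rank (0 for the empty poset)
  Height : Sub n → (Fin n → ℕ) → ℕ → Set
  Height X rk r =
    (∀ x → X x → rk x ≤ r) × (∀ s → (∀ x → X x → rk x ≤ s) → r ≤ s)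

  Dim : Sub n → ℕ → Set
  Dim X d = Card (Minimal X) d

  FVert : Sub n → (Fin n → ℕ) → ℕ → Fin n → Set
  FVert X rk i x = X x × rk x ≡ i

  FAdj : Sub n → (Fin n → ℕ) → ℕ → Fin n → Fin n → Set
  FAdj X rk i x y = Σ (Fin n) λ v →
    X v × rk v ≡ suc i × Covers X v x × Covers X v y × x ≢ y

  HasCycle : Sub n → (Fin n → ℕ) → ℕ → Set
  HasCycle X rk i = Σ (Fin n) λ x → Σ (List (Fin n)) λ ys →
    Unique (x ∷ ys) × 2 ≤ length ys × All (FVert X rk i) (x ∷ ys) ×
    Linked (FAdj X rk i) (x ∷ ys ++ x ∷ [])

  IsForest : Sub n → (Fin n → ℕ) → ℕ → Set
  IsForest X rk i = ¬ HasCycle X rk i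

  IsConnected : Sub n → (Fin n → ℕ) → ℕ → Set
  IsConnected X rk i =
    ∀ x y → FVert X rk i x → FVert X rk i y → Star (FAdj X rk i) x y

  IsTree : Sub n → (Fin n → ℕ) → ℕ → Set
  IsTree X rk i = IsForest X rk i × IsConnected X rk i

  IsVine : Sub n → (Fin n → ℕ) → Set
  IsVine X rk =
    IsRank X rk ×
    (∀ v → X v → ¬ Minimal X v →
       Σ (Fin n) λ a → Σ (Fin n) λ b → a ≢ b × Covers X v a × Covers X v b ×
         (∀ c → Covers X v c → (c ≡ a) ⊎ (c ≡ b))) ×
    (∀ a b → a ≢ b → rk a ≡ rk b → ∀ v w →
       Covers X v a → Covers X v b → Covers X w a → Covers X w b → v ≡ w) ×
    (∀ r → Height X rk r → ∀ i → 1 ≤ i → i ≤ r → IsForest X rk i)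

  IsRVine : Sub n → (Fin n → ℕ) → Set
  IsRVine X rk =
    IsVine X rk ×
    (Σ ℕ λ r → Height X rk r × Dim X r) ×
    (∀ r → Height X rk r → ∀ i → 1 ≤ i → i ≤ r → IsTree X rk i) ×
    (∀ a b → X a → X b → a ≢ b → rk a ≡ rk b → 2 ≤ rk a →
       (Σ (Fin n) λ v → Covers X v a × Covers X v b) →
       Σ (Fin n) λ c → Covers X a c × Covers X b c)

  Ideal : Sub n → Fin n → Sub n
  Ideal X v x = X x × x ⊑ v

  IsLRVine : Sub n → (Fin n → ℕ) → Set
  IsLRVine X rk = IsVine X rk × (∀ v → X v → IsRVine (Ideal X v) rk)

  U : Sub n → Fin n → Sub n
  U X v m = Minimal X m × m ⊑ v

  InC : Sub n → Fin n → Fin n → Set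
  InC X x m = Σ (Fin n) λ a → Σ (Fin n) λ b →
    a ≢ b × Covers X x a × Covers X x b ×
    ((U X a m × ¬ U X b m) ⊎ (U X b m × ¬ U X a m))

  Marg : Sub n → Fin n → Sub n
  Marg X v x = X x × x ≢ v × ¬ InC X x v

  -- margList X (v_{i+1} ∷ … ∷ v_ℓ) = ((X ‖ v_ℓ) ‖ …) ‖ v_{i+1}
  margList : Sub n → List (Fin n) → Sub n
  margList X []       = X
  margList X (w ∷ ws) = Marg (margList X ws) w

  IsSamplingOrder : Sub n → (Fin n → ℕ) → List (Fin n) → Set
  IsSamplingOrder X rk vs =
    IsOrdering (Minimal X) vs ×
    (∀ i → 1 ≤ i → suc i ≤ length vs → IsLRVine (margList X (drop i vs)) rk)

  IsJoin : Sub n → Fin n → Fin n → Fin n → Set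
  IsJoin X i j z = X z × i ⊑ z × j ⊑ z × (∀ w → X w → i ⊑ w → j ⊑ w → z ⊑ w)

record LGraph (n : ℕ) : Set₁ where
  field
    V   : Fin n → Set
    Adj : Fin n → Fin n → Set
    lab : Fin n → Fin n → ℕ

open LGraph public

induced : ∀ {n} → LGraph n → Sub n → LGraph n
induced G S = record
  { V   = λ x → V G x × S x
  ; Adj = λ x y → Adj G x y × S x × S y
  ; lab = lab G }

-- Ω(P) = (G, λ), given as a characterization of G
-- (labels on non-edges are irrelevant)
IsOmega : ∀ {n} (P : FinPoset n) → Sub n → (Fin n → ℕ) → LGraph n → Set
IsOmega {n} P X rk G =
  (∀ x → V G x ⇔ Minimal P X x) ×
  (∀ i j → Adj G i j ⇔
     (Minimal P X i × Minimal P X j × i ≢ j × Σ (Fin n) (IsJoin P X i j))) ×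
  (∀ i j z → Adj G i j → IsJoin P X i j z → suc (lab G i j) ≡ rk z)

Nbr : ∀ {n} → LGraph n → Fin n → Sub n
Nbr G v u = Adj G v u

IsMATSimplicial : ∀ {n} → LGraph n → Fin n → Set
IsMATSimplicial G v =
  V G v ×
  (∀ u₁ u₂ → Nbr G v u₁ → Nbr G v u₂ → u₁ ≢ u₂ → Adj G u₁ u₂) ×
  (Σ ℕ λ d → Card (Nbr G v) d ×
     (∀ u → Nbr G v u → 1 ≤ lab G v u × lab G v u ≤ d) ×
     (∀ k → 1 ≤ k → k ≤ d → Σ _ λ u → Nbr G v u × lab G v u ≡ k)) ×
  (∀ u₁ u₂ → Nbr G v u₁ → Nbr G v u₂ → u₁ ≢ u₂ →
     lab G u₁ u₂ < lab G u₁ v ⊔ lab G u₂ v)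

IsMATPEO : ∀ {n} → LGraph n → List (Fin n) → Set
IsMATPEO G vs =
  IsOrdering (V G) vs ×
  (∀ (i : Fin (length vs)) →
     IsMATSimplicial (induced G (λ x → x ∈ take (suc (toℕ i)) vs))
                     (lookup vs i))

Full : ∀ {n} → Sub n
Full _ = ⊤

{-# OPTIONS --safe #-}
module Submission where

-- A down-closed subset of an LR-vine is again an LR-vine, so it suffices that each marginalization
-- removes exactly the elements above the marginalized v. This holds once there is at most one element
-- above v at each rank. If v is MAT-simplicial, the labels at v are pairwise distinct, and an element x
-- covering a ≥ v and b ≱ v is the join of v with the minimal element below b but not below a, so two
-- elements above v cannot have the same rank. (That x is this join: inside the ideals of x and of any
-- other upper bound, walks at each rank must start with the same edge, because the graphs are forests.)
--
-- For existence, one shows by descending induction on the rank that, besides any given vertex, every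
-- nontrivial component of a forest F contains a good vertex, one whose upper set is a chain. The
-- components of the next forest cut the edges of F into blocks meeting like the blocks of a graph. A good
-- edge of a block has an end that lies on no other edge of that block; moving on through another block at
-- that end never revisits a vertex, so the walk stops at a vertex with a single edge, and that edge is good.

open import Defs
open import Data.Nat using (ℕ; zero; suc; _+_; _≤_; _<_; _⊔_; _∸_; z≤n; s≤s)
open import Data.Nat.Properties as ℕ using (≤-refl; ≤-trans; ≤-reflexive; <-irrefl; <-≤-trans; +-suc; suc-injective; m≤m⊔n; m≤n⊔m; ⊔-lub)
open import Data.Fin using (Fin; zero; suc; toℕ)
open import Data.Fin.Properties as Fin using (_≟_; any?; injective⇒≤; toℕ-injective; toℕ<n)
open import Data.List using (List; []; _∷_; [_]; _++_; length; lookup; tabulate; take; drop)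
open import Data.List.Properties using (length-tabulate; ++-assoc)
open import Data.List.Membership.Propositional using (_∈_; _∉_)
open import Data.List.Membership.Propositional.Properties using (∈-lookup; ∈-tabulate⁻; ∈-allFin; ∈-++⁺ˡ; ∈-++⁺ʳ; ∈-++⁻)
open import Data.List.Membership.Setoid.Properties using (index-injective)
open import Data.List.Relation.Unary.All as All using (All; []; _∷_)
open import Data.List.Relation.Unary.All.Properties using (¬Any⇒All¬)
open import Data.List.Relation.Unary.AllPairs using ([]; _∷_)
open import Data.List.Relation.Unary.Any using (here; there; index)
open import Data.List.Relation.Unary.Linked as Linked using (Linked; [-]; _∷_)
open import Data.List.Relation.Unary.Unique.Propositional using (Unique)
open import Data.List.Relation.Unary.Unique.Propositional.Properties using (tabulate⁺)
open import Data.Product using (Σ; ∃; ∃₂; _×_; _,_; proj₁; proj₂)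
open import Data.Sum using (_⊎_; inj₁; inj₂)
open import Data.Unit using (tt)
open import Function using (_∘_; id)
open import Function.Bundles using (_⇔_; mk⇔; Equivalence)
open import Level using (0ℓ)
open import Relation.Binary.Construct.Closure.ReflexiveTransitive as Star using (Star; ε; _◅_; _◅◅_)
open import Relation.Binary.Core using (Rel)
open import Relation.Binary.PropositionalEquality using (_≡_; _≢_; refl; sym; trans; cong; subst; subst₂; setoid; ≢-sym)
open import Relation.Binary.Structures using (IsPartialOrder)
open import Relation.Nullary using (¬_; Dec; yes; no; contradiction; ¬?; _×-dec_)
open import Relation.Unary using (Decidable)

open Equivalence using (to; from)

-- Lists without repetition

lookup-injective : ∀ {n} {xs : List (Fin n)} → Unique xs →
  ∀ i j → lookup xs i ≡ lookup xs j → i ≡ j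
lookup-injective (_ ∷ _) zero    zero    _  = refl
lookup-injective (p ∷ _) zero    (suc j) eq = contradiction eq (All.lookup p (∈-lookup j))
lookup-injective (p ∷ _) (suc i) zero    eq = contradiction (sym eq) (All.lookup p (∈-lookup i))
lookup-injective (_ ∷ u) (suc i) (suc j) eq = cong suc (lookup-injective u i j eq)

unique-⊆⇒length≤ : ∀ {n} {xs ys : List (Fin n)} → Unique xs →
  (∀ {x} → x ∈ xs → x ∈ ys) → length xs ≤ length ys
unique-⊆⇒length≤ {xs = xs} u sub = injective⇒≤ {f = λ i → index (sub (∈-lookup i))} λ {i} {j} eq →
  lookup-injective u i j (index-injective (setoid _) (sub (∈-lookup i)) (sub (∈-lookup j)) eq)

unique⇒length≤ : ∀ {n} {xs : List (Fin n)} → Unique xs → length xs ≤ n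
unique⇒length≤ {n} u = ≤-trans (unique-⊆⇒length≤ u (λ {x} _ → ∈-allFin x)) (≤-reflexive (length-tabulate id))

unique-∷ : ∀ {n} {x : Fin n} {xs} → x ∉ xs → Unique xs → Unique (x ∷ xs)
unique-∷ x∉xs u = ¬Any⇒All¬ _ x∉xs ∷ u

module _ {n : ℕ} where
  open import Data.List.Membership.DecPropositional (_≟_ {n}) public using (_∈?_)

unique-⊆-length≥⇒⊇ : ∀ {n} {xs ys : List (Fin n)} → Unique xs →
  (∀ {x} → x ∈ xs → x ∈ ys) → length ys ≤ length xs → ∀ {y} → y ∈ ys → y ∈ xs
unique-⊆-length≥⇒⊇ {xs = xs} {ys} u sub le {y} y∈ys with y ∈? xs
... | yes y∈xs = y∈xs
... | no  y∉xs = contradiction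
  (≤-trans (unique-⊆⇒length≤ {ys = ys} (unique-∷ y∉xs u) λ { (here refl) → y∈ys ; (there m) → sub m }) le)
  (<-irrefl refl)

-- Picking one element for each of the labels 1 to `d` gives `d` distinct elements, hence by
-- counting all of `S`. In this form (MS2) says that the labels at a simplicial vertex are distinct.
surjective-label⇒injective : ∀ {n d} (S : Sub n) → Card S d → (lab : Fin n → ℕ) →
  (∀ k → 1 ≤ k → k ≤ d → Σ _ λ u → S u × lab u ≡ k) →
  ∀ {u u′} → S u → S u′ → lab u ≡ lab u′ → u ≡ u′
surjective-label⇒injective {n} {d} S (ns , _ , ns⇔S , refl) lab sur Su Su′ eq
  with in-section Su | in-section Su′
  where
  choice : ∀ (k : Fin d) → Σ _ λ u → S u × lab u ≡ suc (toℕ k)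
  choice k = sur (suc (toℕ k)) (s≤s z≤n) (toℕ<n k)
  section : Fin d → Fin n
  section k = proj₁ (choice k)
  label-injective : ∀ {i j} → lab (section i) ≡ lab (section j) → i ≡ j
  label-injective {i} {j} e = toℕ-injective (suc-injective
    (trans (sym (proj₂ (proj₂ (choice i)))) (trans e (proj₂ (proj₂ (choice j))))))
  section⊆ns : ∀ {x} → x ∈ tabulate section → x ∈ ns
  section⊆ns m with ∈-tabulate⁻ m
  ... | k , refl = from (ns⇔S _) (proj₁ (proj₂ (choice k)))
  in-section : ∀ {x} → S x → ∃ λ k → x ≡ section k × (∀ {j} → lab x ≡ lab (section j) → x ≡ section j)
  in-section Sx with ∈-tabulate⁻ (unique-⊆-length≥⇒⊇ (tabulate⁺ (label-injective ∘ cong lab)) section⊆ns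
    (≤-reflexive (sym (length-tabulate section))) (from (ns⇔S _) Sx))
  ... | k , refl = k , refl , λ e → cong section (label-injective e)
... | _ , refl , _ | _ , refl , same = sym (same (sym eq))

finite-maximum : ∀ {n} (f : Fin n → ℕ) →
  Σ ℕ λ r → (∀ x → f x ≤ r) × (∀ s → (∀ x → f x ≤ s) → r ≤ s)
finite-maximum {zero}  f = 0 , (λ ()) , λ _ _ → z≤n
finite-maximum {suc n} f with finite-maximum (f ∘ suc)
... | r , ub , lub = f zero ⊔ r
  , (λ { zero → m≤m⊔n (f zero) r ; (suc x) → ≤-trans (ub x) (m≤n⊔m (f zero) r) })
  , λ s h → ⊔-lub (h zero) (lub s (h ∘ suc))

-- Walks

module _ {n} {R : Rel (Fin n) 0ℓ} where

  -- The index list omits the start, so `a ∷ xs` is the vertex list in the shape that `HasCycle`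
  -- expects.
  data Path : Fin n → Fin n → List (Fin n) → Set where
    end : ∀ {d} → Path d d []
    _∷_ : ∀ {a b d xs} → R a b → Path b d xs → Path a d (b ∷ xs)

  path-suffix : ∀ {a b d xs} → Path b d xs → Unique (b ∷ xs) → a ∈ b ∷ xs →
    ∃ λ ys → Path a d ys × Unique (a ∷ ys)
  path-suffix p       u       (here refl) = _ , p , u
  path-suffix (_ ∷ p) (_ ∷ u) (there m)   = path-suffix p u m

  loop-erase : ∀ {a d} → Star R a d → ∃ λ xs → Path a d xs × Unique (a ∷ xs)
  loop-erase ε = [] , end , [] ∷ []
  loop-erase {a} (_◅_ {j = b} r s) with loop-erase s
  ... | xs , p , u with a ∈? (b ∷ xs)
  ...   | yes m = path-suffix p u m
  ...   | no  m = b ∷ xs , r ∷ p , unique-∷ m u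

  path⇒linked : ∀ {R′ : Rel (Fin n) 0ℓ} {a d z xs} → (∀ {x y} → R x y → R′ x y) →
    Path a d xs → R′ d z → Linked R′ (a ∷ xs ++ z ∷ [])
  path⇒linked f end     r′ = r′ ∷ [-]
  path⇒linked f (r ∷ p) r′ = f r ∷ path⇒linked f p r′

  path⇒all : ∀ {V : Fin n → Set} {a d xs} → (∀ {x y} → R x y → V x → V y) →
    V a → Path a d xs → All V (a ∷ xs)
  path⇒all f v end     = v ∷ []
  path⇒all f v (r ∷ p) = v ∷ path⇒all f (f r v) p

  Avoiding : Fin n → Rel (Fin n) 0ℓ
  Avoiding a x y = R x y × x ≢ a × y ≢ a

  -- The walk is cut after its last visit to `a`; the first alternative is the case where it never
  -- meets `a`.
  last-visit : ∀ {a x b} → b ≢ a → Star R x b →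
    (x ≢ a × Star (Avoiding a) x b) ⊎ (∃ λ f → R a f × Star (Avoiding a) f b)
  last-visit b≢a ε = inj₁ (b≢a , ε)
  last-visit {a} {x} b≢a (r ◅ s) with last-visit b≢a s
  ... | inj₂ found = inj₂ found
  ... | inj₁ (y≢a , s′) with x ≟ a
  ...   | yes refl = inj₂ (_ , r , s′)
  ...   | no  x≢a  = inj₁ (x≢a , (r , x≢a , y≢a) ◅ s′)

  leave : ∀ {a b} → b ≢ a → Star R a b → ∃ λ f → R a f × Star (Avoiding a) f b
  leave b≢a s with last-visit b≢a s
  ... | inj₁ (a≢a , _) = contradiction refl a≢a
  ... | inj₂ found     = found

-- Restriction to subsets of the carrier

-- Predicates on the carrier agree only up to logical equivalence, so each vine axiom is transported
-- by hand.
_≐_ : ∀ {n} → Sub n → Sub n → Set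
A ≐ B = ∀ x → A x ⇔ B x

≐-sym : ∀ {n} {A B : Sub n} → A ≐ B → B ≐ A
≐-sym e x = mk⇔ (from (e x)) (to (e x))

module _ {n} (P : FinPoset n) where
  open FinPoset P

  module _ {A B : Sub n} (e : A ≐ B) where

    covers-resp : ∀ {y x} → Covers P A y x → Covers P B y x
    covers-resp (Ax , Ay , le , ne , m) =
      to (e _) Ax , to (e _) Ay , le , ne , λ z Bz → m z (from (e z) Bz)

    minimal-resp : ∀ {x} → Minimal P A x → Minimal P B x
    minimal-resp (Ax , m) = to (e _) Ax , λ y By → m y (from (e y) By)

    height-resp : ∀ {rk r} → Height P A rk r → Height P B rk r
    height-resp (ub , lub) = (λ x Bx → ub x (from (e x) Bx)) , λ s h → lub s λ x Ax → h x (to (e x) Ax)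

    fadj-resp : ∀ {rk i x y} → FAdj P A rk i x y → FAdj P B rk i x y
    fadj-resp (v , Av , r , c , c′ , ne) = v , to (e v) Av , r , covers-resp c , covers-resp c′ , ne

    hasCycle-resp : ∀ {rk i} → HasCycle P A rk i → HasCycle P B rk i
    hasCycle-resp {rk} {i} (x , ys , u , le , vs , l) =
      x , ys , u , le , All.map (λ (Ax , r) → to (e _) Ax , r) vs , Linked.map (fadj-resp {rk} {i}) l

  module _ {A B : Sub n} (e : A ≐ B) where
    private
      e⁻¹ : B ≐ A
      e⁻¹ = ≐-sym e

    isVine-resp : ∀ {rk} → IsVine P A rk → IsVine P B rk
    isVine-resp ((mono , step , base) , two , common , forest) =
        ( (λ x y Bx By → mono x y (from (e x) Bx) (from (e y) By))
        , (λ x y c → step x y (covers-resp e⁻¹ c))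
        , (λ x m → base x (minimal-resp e⁻¹ m)))
      , (λ v Bv ¬m → let a , b , ne , ca , cb , only = two v (from (e v) Bv) (¬m ∘ minimal-resp e) in
          a , b , ne , covers-resp e ca , covers-resp e cb , λ c cc → only c (covers-resp e⁻¹ cc))
      , (λ a b ne r v w va vb wa wb → common a b ne r v w (covers-resp e⁻¹ va) (covers-resp e⁻¹ vb)
          (covers-resp e⁻¹ wa) (covers-resp e⁻¹ wb))
      , λ r h i p q → forest r (height-resp e⁻¹ h) i p q ∘ hasCycle-resp e⁻¹

    isRVine-resp : ∀ {rk} → IsRVine P A rk → IsRVine P B rk
    isRVine-resp {rk} (vine , (r , h , xs , u , xs⇔ , len) , trees , prox) =
        isVine-resp vine
      , (r , height-resp e h , xs , u
        , (λ x → mk⇔ (minimal-resp e ∘ to (xs⇔ x)) (from (xs⇔ x) ∘ minimal-resp e⁻¹)) , len)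
      , (λ r h i p q → let forest , conn = trees r (height-resp e⁻¹ h) i p q in
          forest ∘ hasCycle-resp e⁻¹ ,
          λ x y (Bx , rx) (By , ry) → Star.map (fadj-resp e {rk} {i})
            (conn x y (from (e x) Bx , rx) (from (e y) By , ry)))
      , λ a b Ba Bb ne r le (v , va , vb) →
          let c , ac , bc = prox a b (from (e a) Ba) (from (e b) Bb) ne r le
                              (v , covers-resp e⁻¹ va , covers-resp e⁻¹ vb)
          in c , covers-resp e ac , covers-resp e bc

  DownClosed : Sub n → Set
  DownClosed X = ∀ {x y} → X y → x ⊑ y → X x

  module _ {X Y : Sub n} (down : DownClosed X) (X⊆Y : ∀ {x} → X x → Y x) where

    -- Everything of `Y` below an element of `X` is already in `X`, so `Y` inserts nothing between
    -- the two.
    covers-extend : ∀ {y x} → Covers P X y x → Covers P Y y x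
    covers-extend (Xx , Xy , le , ne , m) =
      X⊆Y Xx , X⊆Y Xy , le , ne , λ z _ xz zy → m z (down Xy zy) xz zy

    covers-restrict : ∀ {y x} → X y → Covers P Y y x → Covers P X y x
    covers-restrict Xy (_ , _ , le , ne , m) = down Xy le , Xy , le , ne , λ z Xz → m z (X⊆Y Xz)

    minimal-extend : ∀ {x} → Minimal P X x → Minimal P Y x
    minimal-extend (Xx , m) = X⊆Y Xx , λ y _ le → m y (down Xx le) le

    minimal-restrict : ∀ {x} → X x → Minimal P Y x → Minimal P X x
    minimal-restrict Xx (_ , m) = Xx , λ y Xy → m y (X⊆Y Xy)

    hasCycle-extend : ∀ {rk i} → HasCycle P X rk i → HasCycle P Y rk i
    hasCycle-extend (x , ys , u , le , vs , l) = x , ys , u , le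
      , All.map (λ (Xx , r) → X⊆Y Xx , r) vs
      , Linked.map (λ (v , Xv , r , c , c′ , ne) → v , X⊆Y Xv , r , covers-extend c , covers-extend c′ , ne) l

-- Covers, ranks and axioms of an LR-vine

module LRVine {n} (P : FinPoset n) (rk : Fin n → ℕ) (lr : IsLRVine P Full rk) where
  open FinPoset P
  open IsPartialOrder isPartialOrder using (antisym) renaming (refl to ⊑-refl; trans to ⊑-trans)

  infix 4 _⋖_
  -- Covering expressed through the rank: decidable, and independent of the ambient subset.
  _⋖_ : Fin n → Fin n → Set
  x ⋖ y = x ⊑ y × rk y ≡ suc (rk x)

  _⋖?_ : ∀ x y → Dec (x ⋖ y)
  x ⋖? y = x ⊑? y ×-dec rk y ℕ.≟ suc (rk x)

  vine : IsVine P Full rk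
  vine = proj₁ lr

  ideal : ∀ v → IsRVine P (Ideal P Full v) rk
  ideal v = proj₂ lr v tt

  ideal-down : ∀ {v} → DownClosed P (Ideal P Full v)
  ideal-down (_ , y⊑v) x⊑y = tt , ⊑-trans x⊑y y⊑v

  rk-strict : ∀ {x y} → x ⊑ y → x ≢ y → rk x < rk y
  rk-strict = proj₁ (proj₁ vine) _ _ tt tt

  rk-mono : ∀ {x y} → x ⊑ y → rk x ≤ rk y
  rk-mono {x} {y} le with x ≟ y
  ... | yes refl = ≤-refl
  ... | no  ne   = ℕ.<⇒≤ (rk-strict le ne)

  ⊑-rk≡⇒≡ : ∀ {x y} → x ⊑ y → rk x ≡ rk y → x ≡ y
  ⊑-rk≡⇒≡ {x} {y} le eq with x ≟ y
  ... | yes x≡y = x≡y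
  ... | no  ne  = contradiction (rk-strict le ne) (<-irrefl eq)

  ⋖⇒≢ : ∀ {x y} → x ⋖ y → x ≢ y
  ⋖⇒≢ (_ , eq) refl = ℕ.1+n≢n (sym eq)

  covers⇒⋖ : ∀ {x y} → Covers P Full y x → x ⋖ y
  covers⇒⋖ c@(_ , _ , le , _) = le , proj₁ (proj₂ (proj₁ vine)) _ _ c

  ⋖⇒covers : ∀ {x y} → x ⋖ y → Covers P Full y x
  ⋖⇒covers {x} {y} c@(le , eq) = tt , tt , le , ⋖⇒≢ c , between
    where
    between : ∀ z → _ → x ⊑ z → z ⊑ y → z ≡ x ⊎ z ≡ y
    between z _ xz zy with z ≟ x | z ≟ y
    ... | yes e | _     = inj₁ e
    ... | no  _ | yes e = inj₂ e
    ... | no z≢x | no z≢y = contradiction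
      (<-≤-trans (rk-strict zy z≢y) (≤-trans (≤-reflexive eq) (rk-strict xz (≢-sym z≢x)))) (<-irrefl refl)

  -- Induction on a bound `k` for the rank gap: an element strictly in between splits the interval
  -- into two with smaller gaps.
  saturated-chain : ∀ k {x y} → rk y ≤ rk x + k → x ⊑ y → Star _⋖_ x y
  saturated-chain k {x} {y} bound x⊑y with x ≟ y
  ... | yes refl = ε
  ... | no x≢y with any? (λ z → x ⊑? z ×-dec z ⊑? y ×-dec ¬? (z ≟ x) ×-dec ¬? (z ≟ y))
  ...   | no none = covers⇒⋖ (tt , tt , x⊑y , x≢y , between) ◅ ε
    where
    between : ∀ z → _ → x ⊑ z → z ⊑ y → z ≡ x ⊎ z ≡ y
    between z _ xz zy with z ≟ x | z ≟ y
    ... | yes e | _     = inj₁ e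
    ... | no  _ | yes e = inj₂ e
    ... | no z≢x | no z≢y = contradiction (z , xz , zy , z≢x , z≢y) none
  saturated-chain zero bound x⊑y | no x≢y | yes _ =
    contradiction (≤-trans (rk-strict x⊑y x≢y) (≤-trans bound (≤-reflexive (ℕ.+-identityʳ _)))) (<-irrefl refl)
  saturated-chain (suc k) {x} {y} bound x⊑y | no x≢y | yes (z , xz , zy , z≢x , z≢y) =
    saturated-chain k (ℕ.≤-pred (≤-trans (rk-strict zy z≢y) bound′)) xz ◅◅
    saturated-chain k (≤-trans bound′ (ℕ.+-monoˡ-≤ k (rk-strict xz (≢-sym z≢x)))) zy
    where
    bound′ : rk y ≤ suc (rk x + k)
    bound′ = ≤-trans bound (≤-reflexive (+-suc (rk x) k))

  chain : ∀ {x y} → x ⊑ y → Star _⋖_ x y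
  chain {y = y} = saturated-chain (rk y) (ℕ.m≤n+m (rk y) _)

  chain⇒⊑ : ∀ {x y} → Star _⋖_ x y → x ⊑ y
  chain⇒⊑ = Star.fold _⊑_ (λ c → ⊑-trans (proj₁ c)) ⊑-refl

  upper-cover : ∀ {x y} → x ⊑ y → x ≢ y → ∃ λ z → x ⋖ z × z ⊑ y
  upper-cover le ne with chain le
  ... | ε     = contradiction refl ne
  ... | c ◅ s = _ , c , chain⇒⊑ s

  lower-cover : ∀ {x y} → x ⊑ y → x ≢ y → ∃ λ z → x ⊑ z × z ⋖ y
  lower-cover le ne with last (chain le)
    where
    last : ∀ {x y} → Star _⋖_ x y → x ≡ y ⊎ ∃ λ z → x ⊑ z × z ⋖ y
    last ε = inj₁ refl
    last (c ◅ s) with last s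
    ... | inj₁ refl           = inj₂ (_ , ⊑-refl , c)
    ... | inj₂ (z , le , c′) = inj₂ (z , ⊑-trans (proj₁ c) le , c′)
  ... | inj₁ eq    = contradiction eq ne
  ... | inj₂ found = found

  minimal⇒rk≡1 : ∀ {x} → Minimal P Full x → rk x ≡ 1
  minimal⇒rk≡1 = proj₂ (proj₂ (proj₁ vine)) _

  minimal-or-lower-cover : ∀ x → Minimal P Full x ⊎ ∃ λ z → z ⋖ x
  minimal-or-lower-cover x with any? (λ y → y ⊑? x ×-dec ¬? (y ≟ x))
  ... | yes (y , le , ne) = let z , _ , zx = lower-cover le ne in inj₂ (z , zx)
  ... | no none = inj₁ (tt , λ y _ le → min y le)
    where
    min : ∀ y → y ⊑ x → y ≡ x
    min y le with y ≟ x
    ... | yes e  = e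
    ... | no  ne = contradiction (y , le , ne) none

  rk>0 : ∀ x → 1 ≤ rk x
  rk>0 x with minimal-or-lower-cover x
  ... | inj₁ m            = ≤-reflexive (sym (minimal⇒rk≡1 m))
  ... | inj₂ (_ , _ , eq) = subst (1 ≤_) (sym eq) (s≤s z≤n)

  rk≡1⇒minimal : ∀ {x} → rk x ≡ 1 → Minimal P Full x
  rk≡1⇒minimal {x} eq = tt , λ y _ le → ⊑-rk≡⇒≡ le (ℕ.≤-antisym (rk-mono le) (≤-trans (≤-reflexive eq) (rk>0 y)))

  two-covers : ∀ {c y} → c ⋖ y → ∃₂ λ a b → a ≢ b × a ⋖ y × b ⋖ y × (∀ {z} → z ⋖ y → z ≡ a ⊎ z ≡ b)
  two-covers {c} {y} (le , eq) with proj₁ (proj₂ vine) y tt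
    (λ m → ⋖⇒≢ (le , eq) (proj₂ m c tt le))
  ... | a , b , ne , ca , cb , only = a , b , ne , covers⇒⋖ ca , covers⇒⋖ cb , only _ ∘ ⋖⇒covers

  other-cover : ∀ {c y} → c ⋖ y → ∃ λ d → d ⋖ y × d ≢ c
  other-cover {c} cy with two-covers cy
  ... | a , b , ne , ay , by , only with only cy
  ...   | inj₁ refl = b , by , ≢-sym ne
  ...   | inj₂ refl = a , ay , ne

  only-other-cover : ∀ {a b c y} → a ⋖ y → b ⋖ y → c ⋖ y → a ≢ c → b ≢ c → a ≡ b
  only-other-cover ay by cy a≢c b≢c with two-covers cy
  ... | _ , _ , _ , _ , _ , only with only ay | only by | only cy
  ...   | inj₁ refl | inj₁ refl | _         = refl
  ...   | inj₂ refl | inj₂ refl | _         = refl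
  ...   | inj₁ refl | inj₂ refl | inj₁ refl = contradiction refl a≢c
  ...   | inj₁ refl | inj₂ refl | inj₂ refl = contradiction refl b≢c
  ...   | inj₂ refl | inj₁ refl | inj₁ refl = contradiction refl b≢c
  ...   | inj₂ refl | inj₁ refl | inj₂ refl = contradiction refl a≢c

  common-cover-unique : ∀ {a b v w} → a ≢ b → a ⋖ v → b ⋖ v → a ⋖ w → b ⋖ w → v ≡ w
  common-cover-unique ne av bv aw bw = proj₁ (proj₂ (proj₂ vine)) _ _ ne
    (suc-injective (trans (sym (proj₂ av)) (proj₂ bv))) _ _ (⋖⇒covers av) (⋖⇒covers bv) (⋖⇒covers aw) (⋖⇒covers bw)

  height : ∃ λ r → Height P Full rk r
  height with finite-maximum rk
  ... | r , ub , lub = r , (λ x _ → ub x) , λ s h → lub s (λ x → h x tt)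

  -- A vertex of the cycle has rank `i`, which puts `i` in the range where the forest axiom applies.
  acyclic : ∀ i → ¬ HasCycle P Full rk i
  acyclic i cyc@(x , ys , u , le , (_ , eq) ∷ vs , l) =
    proj₂ (proj₂ (proj₂ vine)) (proj₁ height) (proj₂ height) i
      (subst (1 ≤_) eq (rk>0 x)) (subst (_≤ proj₁ height) eq (proj₁ (proj₂ height) x tt)) cyc

  -- For `v` in `X` the principal ideals in `X` and in the whole poset coincide, and the vine axioms
  -- only look downwards or forbid cycles.
  downClosed⇒isLRVine : ∀ {X} → DownClosed P X → IsLRVine P X rk
  downClosed⇒isLRVine {X} down = isVine , λ v Xv → isRVine-resp P (same v Xv) (ideal v)
    where
    same : ∀ v → X v → Ideal P Full v ≐ Ideal P X v
    same v Xv x = mk⇔ (λ (_ , le) → down Xv le , le) (λ (_ , le) → tt , le)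
    ext : ∀ {y x} → Covers P X y x → Covers P Full y x
    ext = covers-extend P down (λ _ → tt)
    isVine : IsVine P X rk
    isVine =
        ( (λ x y _ _ → rk-strict)
        , (λ x y c → proj₂ (covers⇒⋖ (ext c)))
        , (λ x m → minimal⇒rk≡1 (minimal-extend P down (λ _ → tt) m)))
      , (λ v Xv ¬m → let a , b , ne , ca , cb , only = proj₁ (proj₂ vine) v tt
                            (¬m ∘ minimal-restrict P {Y = Full} down (λ _ → tt) Xv)
                     in a , b , ne , covers-restrict P down (λ _ → tt) Xv ca
                          , covers-restrict P down (λ _ → tt) Xv cb , λ c cc → only c (ext cc))
      , (λ a b ne r v w va vb wa wb → proj₁ (proj₂ (proj₂ vine)) a b ne r v w (ext va) (ext vb) (ext wa) (ext wb))
      , λ r h i p q → acyclic i ∘ hasCycle-extend P down (λ _ → tt)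

  -- Walks along the edges lying in a given set

  -- The element `h` is the edge joining `x` and `y`, so `Q` selects edges, not vertices.
  Link : Sub n → Rel (Fin n) 0ℓ
  Link Q x y = x ≢ y × ∃ λ h → Q h × x ⋖ h × y ⋖ h

  Conn : Sub n → Rel (Fin n) 0ℓ
  Conn Q = Star (Link Q)

  link-sym : ∀ {Q x y} → Link Q x y → Link Q y x
  link-sym (ne , h , Qh , xh , yh) = ≢-sym ne , h , Qh , yh , xh

  conn-sym : ∀ {Q x y} → Conn Q x y → Conn Q y x
  conn-sym = Star.reverse link-sym

  link-mono : ∀ {Q Q′ : Sub n} {x y} → (∀ {h} → Q h → Q′ h) → Link Q x y → Link Q′ x y
  link-mono f (ne , h , Qh , xh , yh) = ne , h , f Qh , xh , yh

  conn-mono : ∀ {Q Q′ : Sub n} {x y} → (∀ {h} → Q h → Q′ h) → Conn Q x y → Conn Q′ x y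
  conn-mono f = Star.map (link-mono f)

  hop : ∀ {Q : Sub n} {h x y} → Q h → x ⋖ h → y ⋖ h → Conn Q x y
  hop {x = x} {y} Qh xh yh with x ≟ y
  ... | yes refl = ε
  ... | no  ne   = (ne , _ , Qh , xh , yh) ◅ ε

  link⇒rk≡ : ∀ {Q x y} → Link Q x y → rk x ≡ rk y
  link⇒rk≡ (_ , _ , _ , (_ , xh) , (_ , yh)) = suc-injective (trans (sym xh) yh)

  conn⇒rk≡ : ∀ {Q x y} → Conn Q x y → rk x ≡ rk y
  conn⇒rk≡ ε       = refl
  conn⇒rk≡ (l ◅ s) = trans (link⇒rk≡ l) (conn⇒rk≡ s)

  conn-ranked : ∀ {Q x y i} → rk x ≡ i → Conn Q x y → Star (λ a b → Link Q a b × rk a ≡ i) x y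
  conn-ranked eq ε       = ε
  conn-ranked eq (l ◅ s) = (l , eq) ◅ conn-ranked (trans (sym (link⇒rk≡ l)) eq) s

  -- A walk avoiding `e` would close a cycle with `e`. A loop-erased walk of length one is excluded
  -- because `c` and `d` have only one common cover.
  bridge : ∀ {c d e} → c ⋖ e → d ⋖ e → c ≢ d → ¬ Conn (_≢ e) c d
  bridge {c} {d} {e} ce de c≢d s with loop-erase (conn-ranked refl s)
  ... | [] , end , _ = contradiction refl c≢d
  ... | _ ∷ [] , ((_ , h , h≢e , ch , dh) , _) ∷ end , _ = h≢e (common-cover-unique c≢d ch dh ce de)
  ... | ys@(_ ∷ _ ∷ _) , p , u = acyclic (rk c)
    (c , ys , u , s≤s (s≤s z≤n)
    , path⇒all (λ (l , _) (_ , eq) → tt , trans (sym (link⇒rk≡ l)) eq) (tt , refl) p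
    , path⇒linked
        (λ ((ne , h , _ , ah , bh) , eq) → h , tt , trans (proj₂ ah) (cong suc eq) , ⋖⇒covers ah , ⋖⇒covers bh , ne)
        p (e , tt , proj₂ ce , ⋖⇒covers de , ⋖⇒covers ce , ≢-sym c≢d))

  -- An edge has only two ends, so a step that avoids `p` cannot run along an edge at `p`.
  avoid-edge : ∀ {Q : Sub n} {p e x y} → p ⋖ e → Star (Avoiding {R = Link Q} p) x y → Conn (λ h → Q h × h ≢ e) x y
  avoid-edge pe = Star.map λ { ((ne , h , Qh , xh , yh) , x≢p , y≢p) →
    ne , h , (Qh , λ { refl → ne (only-other-cover xh yh pe x≢p y≢p) }) , xh , yh }

  -- Joins

  ideal-height : ∀ v → Height P (Ideal P Full v) rk (rk v)
  ideal-height v = (λ x (_ , le) → rk-mono le) , λ s h → h v (tt , ⊑-refl)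

  ideal-covers⇒⋖ : ∀ {v x y} → Covers P (Ideal P Full v) y x → x ⋖ y
  ideal-covers⇒⋖ c = covers⇒⋖ (covers-extend P ideal-down (λ _ → tt) c)

  ⋖⇒ideal-covers : ∀ {v x y} → y ⊑ v → x ⋖ y → Covers P (Ideal P Full v) y x
  ⋖⇒ideal-covers y⊑v c = covers-restrict P ideal-down (λ _ → tt) (tt , y⊑v) (⋖⇒covers c)

  ideal-connected : ∀ {v p q} → p ⊑ v → q ⊑ v → rk p ≡ rk q → Conn (_⊑ v) p q
  ideal-connected {v} {p} {q} p⊑v q⊑v eq = Star.map
    (λ (h , (_ , h⊑v) , _ , ch , ch′ , ne) → ne , h , h⊑v , ideal-covers⇒⋖ ch , ideal-covers⇒⋖ ch′)
    (proj₂ (proj₁ (proj₂ (proj₂ (ideal v))) (rk v) (ideal-height v) (rk p) (rk>0 p) (rk-mono p⊑v))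
      p q ((tt , p⊑v) , refl) ((tt , q⊑v) , sym eq))

  proximity : ∀ {h a b} → a ⋖ h → b ⋖ h → a ≢ b → 2 ≤ rk a → ∃ λ c → c ⋖ a × c ⋖ b
  proximity {h} {a} {b} ah bh ne le with proj₂ (proj₂ (proj₂ (ideal h))) a b (tt , proj₁ ah) (tt , proj₁ bh) ne
    (suc-injective (trans (sym (proj₂ ah)) (proj₂ bh))) le
    (h , ⋖⇒ideal-covers ⊑-refl ah , ⋖⇒ideal-covers ⊑-refl bh)
  ... | c , ca , cb = c , ideal-covers⇒⋖ ca , ideal-covers⇒⋖ cb

  -- The walks from p to q inside the two ideals start with the same edge, for otherwise they close a cycle.
  common-edge : ∀ {x w p q} → p ⊑ x → q ⊑ x → p ⊑ w → q ⊑ w → p ≢ q → rk p ≡ rk q →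
    ∃ λ e → p ⋖ e × e ⊑ x × e ⊑ w
  common-edge px qx pw qw p≢q eq
    with leave (≢-sym p≢q) (ideal-connected px qx eq) | leave (≢-sym p≢q) (ideal-connected pw qw eq)
  ... | f , (p≢f , e , e⊑x , pe , fe) , s | f′ , (p≢f′ , e′ , e′⊑w , pe′ , f′e′) , s′ with e ≟ e′
  ...   | yes refl = e , pe , e⊑x , e′⊑w
  ...   | no  e≢e′ = contradiction
    (conn-mono proj₂ (avoid-edge pe s) ◅◅ conn-sym (conn-mono proj₂ (avoid-edge pe s′))
      ◅◅ hop (≢-sym e≢e′) f′e′ pe′)
    (bridge fe pe (≢-sym p≢f))

  -- Climbing one rank at a time above `i` and `j`, both climbers stay below `x` and `w`. They
  -- remain distinct before reaching `x`, since otherwise some element covered by `x` would lie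
  -- above both `i` and `j`.
  separated⇒⊑ : ∀ k {x w p q i j} → (∀ {z} → z ⋖ x → i ⊑ z → ¬ j ⊑ z) →
    i ⊑ p → p ⊑ x → p ⊑ w → j ⊑ q → q ⊑ x → q ⊑ w →
    rk p ≡ rk q → rk x ≡ rk p + k → x ⊑ w
  separated⇒⊑ zero sep ip px pw jq qx qw eq top with ⊑-rk≡⇒≡ px (sym (trans top (ℕ.+-identityʳ _)))
  ... | refl = pw
  separated⇒⊑ (suc k) {x} {w} {p} {q} sep ip px pw jq qx qw eq top
    with common-edge px qx pw qw p≢q eq | common-edge qx px qw pw (≢-sym p≢q) (sym eq)
    where
    p≢x : p ≢ x
    p≢x refl = ℕ.m≢1+m+n (rk p) (trans top (+-suc (rk p) k))
    p≢q : p ≢ q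
    p≢q refl with lower-cover px p≢x
    ... | z , pz , zx = sep zx (⊑-trans ip pz) (⊑-trans jq pz)
  ... | e , pe , ex , ew | e′ , qe′ , e′x , e′w =
    separated⇒⊑ k sep (⊑-trans ip (proj₁ pe)) ex ew (⊑-trans jq (proj₁ qe′)) e′x e′w
      (trans (proj₂ pe) (trans (cong suc eq) (sym (proj₂ qe′))))
      (trans top (trans (+-suc (rk p) k) (cong (_+ k) (sym (proj₂ pe)))))

  -- The elements covered by `x` are `a` and `b`, and neither is above both `i` and `j`; this is the
  -- separation needed for the climb.
  conditioned⇒join : ∀ {x a b i j} → a ⋖ x → b ⋖ x → Minimal P Full i → Minimal P Full j →
    i ⊑ a → ¬ i ⊑ b → j ⊑ b → ¬ j ⊑ a → IsJoin P Full i j x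
  conditioned⇒join {x} {a} {b} {i} {j} ax bx mi mj ia i⋢b jb j⋢a =
    tt , ⊑-trans ia (proj₁ ax) , ⊑-trans jb (proj₁ bx) , λ w _ iw jw →
      separated⇒⊑ (rk x ∸ rk i) sep ⊑-refl (⊑-trans ia (proj₁ ax)) iw ⊑-refl (⊑-trans jb (proj₁ bx)) jw
        (trans (minimal⇒rk≡1 mi) (sym (minimal⇒rk≡1 mj)))
        (sym (ℕ.m+[n∸m]≡n (rk-mono (⊑-trans ia (proj₁ ax)))))
    where
    sep : ∀ {z} → z ⋖ x → i ⊑ z → ¬ j ⊑ z
    sep {z} zx iz jz with z ≟ a
    ... | yes refl = j⋢a jz
    ... | no  z≢a  with only-other-cover zx bx ax z≢a (λ { refl → i⋢b ia })
    ...   | refl = i⋢b iz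

  U-card : ∀ v → Card (U P Full v) (rk v)
  U-card v with proj₁ (proj₂ (ideal v))
  ... | r , h , xs , u , xs⇔ , len = xs , u
    , (λ x → mk⇔ (λ m → let m′ = to (xs⇔ x) m in minimal-extend P ideal-down (λ _ → tt) m′ , proj₂ (proj₁ m′))
                 (λ (m , le) → from (xs⇔ x) (minimal-restrict P ideal-down (λ _ → tt) (tt , le) m)))
    , trans len (ℕ.≤-antisym (proj₂ h (rk v) (proj₁ (ideal-height v))) (proj₁ h v (tt , ⊑-refl)))

  -- The sets of minimal elements below `a` and below `b` have equal size; if the second were
  -- contained in the first, they would agree, but `v` is only in the first.
  exchange : ∀ {a b v} → rk a ≡ rk b → Minimal P Full v → v ⊑ a → ¬ v ⊑ b →
    ∃ λ u → Minimal P Full u × u ⊑ b × ¬ u ⊑ a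
  exchange {a} {b} {v} eq mv va v⋢b with any? (λ u → rk u ℕ.≟ 1 ×-dec u ⊑? b ×-dec ¬? (u ⊑? a))
  ... | yes (u , r , ub , u⋢a) = u , rk≡1⇒minimal r , ub , u⋢a
  ... | no none with U-card a | U-card b
  ...   | as , _ , as⇔ , la | bs , u , bs⇔ , lb = contradiction
    (proj₂ (to (bs⇔ v) (unique-⊆-length≥⇒⊇ u bs⊆as
      (≤-reflexive (trans la (trans eq (sym lb)))) (from (as⇔ v) (mv , va))))) v⋢b
    where
    bs⊆as : ∀ {x} → x ∈ bs → x ∈ as
    bs⊆as {x} m with to (bs⇔ x) m
    ... | mx , xb with x ⊑? a
    ...   | yes xa = from (as⇔ x) (mx , xa)
    ...   | no x⋢a = contradiction (x , minimal⇒rk≡1 mx , xb , x⋢a) none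

  -- Marginalization

  -- For down-closed X: the elements of X above v form a chain.
  Good : Sub n → Fin n → Set
  Good X v = ∀ {x y} → X x → X y → v ⊑ x → v ⊑ y → rk x ≡ rk y → x ≡ y

  -- If `x` lies strictly above `v`, it covers some `a` above `v`. Goodness keeps the other covered
  -- element from being above `v`, so `v` is in the conditioned set.
  marg-good : ∀ {X v} → DownClosed P X → Minimal P Full v → Good X v →
    Marg P X v ≐ λ x → X x × ¬ v ⊑ x
  marg-good {X} {v} down mv good x = mk⇔
    (λ (Xx , x≢v , ∉C) → Xx , λ vx → ∉C (conditioned Xx (≢-sym x≢v) vx))
    (λ (Xx , v⋢x) → Xx , (λ { refl → v⋢x ⊑-refl }) , v⋢x ∘ InC⇒⊑)
    where
    InC⇒⊑ : InC P X x v → v ⊑ x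
    InC⇒⊑ (a , b , _ , (_ , _ , ax , _) , _ , inj₁ ((_ , va) , _)) = ⊑-trans va ax
    InC⇒⊑ (a , b , _ , _ , (_ , _ , bx , _) , inj₂ ((_ , vb) , _)) = ⊑-trans vb bx
    conditioned : X x → v ≢ x → v ⊑ x → InC P X x v
    conditioned Xx v≢x vx with lower-cover vx v≢x
    ... | a , va , ax with other-cover ax
    ...   | b , bx , b≢a = a , b , ≢-sym b≢a
      , covers-restrict P down (λ _ → tt) Xx (⋖⇒covers ax) , covers-restrict P down (λ _ → tt) Xx (⋖⇒covers bx)
      , inj₁ ((minimal-restrict P down (λ _ → tt) (down Xx vx) mv , va)
             , λ (_ , vb) → b≢a (good (down Xx (proj₁ bx)) (down Xx (proj₁ ax)) vb va
                                   (suc-injective (trans (sym (proj₂ bx)) (proj₂ ax)))))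

  -- The expected value of `margList P Full ws`, in a form that is decidable and visibly
  -- down-closed.
  Survives : List (Fin n) → Sub n
  Survives ws x = All (λ w → ¬ w ⊑ x) ws

  survives-down : ∀ ws → DownClosed P (Survives ws)
  survives-down ws sy xy = All.map (λ w⋢y wx → w⋢y (⊑-trans wx xy)) sy

  survives? : ∀ ws → Decidable (Survives ws)
  survives? ws x = All.all? (λ w → ¬? (w ⊑? x)) ws

  -- As in `margList`, the head is removed last, so its goodness is asked only among the survivors
  -- of the tail.
  data Eliminable : List (Fin n) → Set where
    []  : Eliminable []
    _∷_ : ∀ {w ws} → Minimal P Full w × Good (Survives ws) w → Eliminable ws → Eliminable (w ∷ ws)

  margList≐survives : ∀ {ws} → Eliminable ws → margList P Full ws ≐ Survives ws
  margList≐survives []                             x = mk⇔ (λ _ → []) (λ _ → tt)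
  margList≐survives {w ∷ ws} ((mw , good) ∷ el) x = mk⇔
    (λ m → let Mx , w⋢x = to (marg x) m in w⋢x ∷ to (e x) Mx)
    (λ { (w⋢x ∷ s) → from (marg x) (from (e x) s , w⋢x) })
    where
    e : margList P Full ws ≐ Survives ws
    e = margList≐survives el
    marg : Marg P (margList P Full ws) w ≐ λ x → margList P Full ws x × ¬ w ⊑ x
    marg = marg-good (λ My xy → from (e _) (survives-down ws (to (e _) My) xy)) mw
      (λ Mx My → good (to (e _) Mx) (to (e _) My))

  eliminable-drop : ∀ i {ws} → Eliminable ws → Eliminable (drop i ws)
  eliminable-drop zero    el       = el
  eliminable-drop (suc i) []       = []
  eliminable-drop (suc i) (_ ∷ el) = eliminable-drop i el

  eliminable⇒sampling : ∀ {vs} → IsOrdering (Minimal P Full) vs → Eliminable vs → IsSamplingOrder P Full rk vs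
  eliminable⇒sampling {vs} ord el = ord , λ i _ _ → let e = margList≐survives (eliminable-drop i el) in
    downClosed⇒isLRVine λ My xy → from (e _) (survives-down (drop i vs) (to (e _) My) xy)

  -- MAT-perfect elimination orderings

  join-unique : ∀ {i j x y} → IsJoin P Full i j x → IsJoin P Full i j y → x ≡ y
  join-unique (_ , ix , jx , x-least) (_ , iy , jy , y-least) = antisym (x-least _ tt iy jy) (y-least _ tt ix jx)

  simplicial-at : ∀ {G : LGraph n} pre v suf → IsMATPEO G (pre ++ v ∷ suf) →
    IsMATSimplicial (induced G (_∈ (pre ++ [ v ]))) v
  simplicial-at {G} pre v suf (_ , simp) with position pre
    where
    position : ∀ pre → ∃ λ (i : Fin (length (pre ++ v ∷ suf))) →
      lookup (pre ++ v ∷ suf) i ≡ v × take (suc (toℕ i)) (pre ++ v ∷ suf) ≡ pre ++ [ v ]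
    position []        = zero , refl , refl
    position (x ∷ pre) with position pre
    ... | i , at , upto = suc i , at , cong (x ∷_) upto
  ... | i , at , upto = subst₂ (λ ws → IsMATSimplicial (induced G (_∈ ws))) upto at (simp i)

  module _ (G : LGraph n) (omega : IsOmega P Full rk G) where

    -- Induction on the rank: a survivor strictly above `v` is the join of `v` with a neighbour,
    -- whose label is one less than the rank; distinct labels then leave one survivor per rank.
    simplicial⇒good : ∀ pre v suf → IsMATPEO G (pre ++ v ∷ suf) → Minimal P Full v → Good (Survives suf) v
    simplicial⇒good pre v suf peo mv = λ Sx Sy vx vy eq → at-rank _ Sx Sy vx vy eq refl
      where
      G′ : LGraph n
      G′ = induced G (_∈ (pre ++ [ v ]))

      early : ∀ {u x} → Minimal P Full u → u ⊑ x → Survives suf x → u ∈ pre ++ [ v ]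
      early {u} mu ux Sx with ∈-++⁻ pre (from (proj₂ (proj₁ peo) u) (from (proj₁ omega u) mu))
      ... | inj₁ u∈pre          = ∈-++⁺ˡ u∈pre
      ... | inj₂ (here refl)    = ∈-++⁺ʳ pre (here refl)
      ... | inj₂ (there u∈suf) = contradiction ux (All.lookup Sx u∈suf)

      same-label : ∀ {u u′} → Nbr G′ v u → Nbr G′ v u′ → lab G v u ≡ lab G v u′ → u ≡ u′
      same-label with proj₁ (proj₂ (proj₂ (simplicial-at {G} pre v suf peo)))
      ... | _ , card , _ , labels = surjective-label⇒injective (Nbr G′ v) card (lab G v) labels

      UniqueAt : ℕ → Set
      UniqueAt r = ∀ {x y} → Survives suf x → Survives suf y → v ⊑ x → v ⊑ y → rk x ≡ rk y → rk x ≡ r → x ≡ y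

      neighbour-via : ∀ {x a b} → Survives suf x → a ⋖ x → b ⋖ x → v ⊑ a → ¬ v ⊑ b →
        ∃ λ u → Nbr G′ v u × IsJoin P Full v u x
      neighbour-via Sx ax bx va v⋢b
        with exchange (suc-injective (trans (sym (proj₂ ax)) (proj₂ bx))) mv va v⋢b
      ... | u , mu , ub , u⋢a = u
        , ( from (proj₁ (proj₂ omega) v u) (mv , mu , (λ { refl → u⋢a va }) , _ , join)
          , early mv (⊑-trans va (proj₁ ax)) Sx , early mu (⊑-trans ub (proj₁ bx)) Sx)
        , join
        where join = conditioned⇒join ax bx mv mu va v⋢b ub u⋢a

      neighbour : ∀ {r x} → UniqueAt r → rk x ≡ suc r → x ≢ v → Survives suf x → v ⊑ x →
        ∃ λ u → Nbr G′ v u × IsJoin P Full v u x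
      neighbour unique rx x≢v Sx vx with lower-cover vx (≢-sym x≢v)
      ... | a , va , ax with other-cover ax
      -- If `b` were above `v` too, `a` and `b` would be two such survivors of rank `r`.
      ...   | b , bx , b≢a = neighbour-via Sx ax bx va λ vb →
        b≢a (unique (survives-down suf Sx (proj₁ bx)) (survives-down suf Sx (proj₁ ax)) vb va
          (suc-injective (trans (sym (proj₂ bx)) (proj₂ ax))) (suc-injective (trans (sym (proj₂ bx)) rx)))

      label-determines : ∀ {x y} → rk x ≡ rk y → (∃ λ u → Nbr G′ v u × IsJoin P Full v u x) →
        (∃ λ u → Nbr G′ v u × IsJoin P Full v u y) → x ≡ y
      label-determines {x} {y} eq (u , nu , jx) (u′ , nu′ , jy) = join-unique jx
        (subst (λ u → IsJoin P Full v u y) (sym (same-label nu nu′ (suc-injective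
          (trans (label u x (proj₁ nu) jx) (trans eq (sym (label u′ y (proj₁ nu′) jy))))))) jy)
        where
        label : ∀ u x → Adj G v u → IsJoin P Full v u x → suc (lab G v u) ≡ rk x
        label = proj₂ (proj₂ omega) v

      at-rank : ∀ r → UniqueAt r
      at-rank zero {x} Sx Sy vx vy eq rx = contradiction (subst (1 ≤_) rx (rk>0 x)) λ ()
      at-rank (suc r) {x} {y} Sx Sy vx vy eq rx with x ≟ v | y ≟ v
      ... | yes refl | _        = ⊑-rk≡⇒≡ vy eq
      ... | no _     | yes refl = sym (⊑-rk≡⇒≡ vx (sym eq))
      ... | no x≢v   | no y≢v   = label-determines eq
        (neighbour (at-rank r) rx x≢v Sx vx) (neighbour (at-rank r) (trans (sym eq) rx) y≢v Sy vy)

    peo⇒ordering : ∀ {vs} → IsMATPEO G vs → IsOrdering (Minimal P Full) vs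
    peo⇒ordering ((u , vs⇔) , _) = u , λ x →
      mk⇔ (to (proj₁ omega x) ∘ to (vs⇔ x)) (from (vs⇔ x) ∘ from (proj₁ omega x))

    peo⇒eliminable : ∀ pre suf → IsMATPEO G (pre ++ suf) → Eliminable suf
    peo⇒eliminable pre []        peo = []
    peo⇒eliminable pre (v ∷ suf) peo = (mv , simplicial⇒good pre v suf peo mv)
      ∷ peo⇒eliminable (pre ++ [ v ]) suf (subst (IsMATPEO G) (sym (++-assoc pre [ v ] suf)) peo)
      where
      mv : Minimal P Full v
      mv = to (proj₂ (peo⇒ordering peo) v) (∈-++⁺ʳ pre (here refl))

  -- Existence of good minimal elements

  module _ {X : Sub n} (X? : Decidable X) (down : DownClosed P X) where

    -- A component of the graph on the rank of g; its members are edges of the graph one rank below.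
    Block : Fin n → Sub n
    Block g h = X h × Conn X g h

    Outside : Fin n → Sub n
    Outside g h = X h × ¬ Conn X g h

    -- By proximity, linked elements share a lower cover, so a walk descends to the rank below,
    -- where the vertices of the old walk serve as edges.
    lift : ∀ {Q : Sub n} {f h c d} → Q f → Star (λ a b → Link X a b × Q b) f h → c ⋖ f → d ⋖ h → Conn Q c d
    lift Qf ε                           cf dh = hop Qf cf dh
    lift {c = c} Qf ((l@(ne , _ , _ , am , bm) , Qb) ◅ s) cf dh
      with proximity am bm ne (≤-trans (s≤s (rk>0 c)) (≤-reflexive (sym (proj₂ cf))))
    ... | c′ , c′f , c′b = hop Qf cf c′f ◅◅ lift Qb s c′b dh

    link⇒∈ : ∀ {x y} → Link X x y → X y
    link⇒∈ (_ , _ , Xm , _ , ym) = down Xm (proj₁ ym)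

    within-block : ∀ {g a b} → Conn X g a → Conn X a b → Star (λ a b → Link X a b × Block g b) a b
    within-block ga ε       = ε
    within-block ga (l ◅ s) = (l , link⇒∈ l , gl) ◅ within-block gl s
      where gl = ga ◅◅ l ◅ ε

    within-block-avoiding : ∀ {g a b e} → Conn X g a → Star (Avoiding {R = Link X} e) a b →
      Star (λ a b → Link X a b × (Block g b × b ≢ e)) a b
    within-block-avoiding ga ε                   = ε
    within-block-avoiding ga ((l , _ , b≢e) ◅ s) = (l , (link⇒∈ l , gl) , b≢e) ◅ within-block-avoiding gl s
      where gl = ga ◅◅ l ◅ ε

    -- A good edge e of the block of g, reached from the end ρ of g, whose far end d meets the block only in e.
    record Tip (ρ g : Fin n) : Set where
      field
        {e c d} : Fin n
        in-block : Block g e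
        c⋖e      : c ⋖ e
        d⋖e      : d ⋖ e
        d≢c      : d ≢ c
        reach    : Conn (λ h → Block g h × h ≢ e) ρ c
        good     : Good X e
        leaf     : ∀ {h} → Block g h → d ⋖ h → h ≡ e

    HasUpperCover : Fin n → Set
    HasUpperCover x = ∃ λ y → X y × x ⋖ y

    hasUpperCover? : Decidable HasUpperCover
    hasUpperCover? x = any? λ y → X? y ×-dec x ⋖? y

    maximal⇒good : ∀ {x} → ¬ HasUpperCover x → Good X x
    maximal⇒good {x} none Xy Xz xy xz _ = trans (sym (only Xy xy)) (only Xz xz)
      where
      only : ∀ {y} → X y → x ⊑ y → x ≡ y
      only {y} Xy xy with x ≟ y
      ... | yes eq = eq
      ... | no  ne with upper-cover xy ne
      ...   | z , xz , zy = contradiction (z , down Xy zy , xz) none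

    GoodNear : Fin n → Set
    GoodNear u = ∃ λ v → v ≢ u × Conn X u v × Good X v

    -- If `g` has no upper cover, it is alone in its block. Otherwise the induction hypothesis gives
    -- a good `e` other than `g`; its single upper cover yields a single neighbour `f`, and `c` is
    -- the end shared with `f`.
    tip : ∀ {ρ g} → X g → ρ ⋖ g → (HasUpperCover g → GoodNear g) → Tip ρ g
    tip {ρ} {g} Xg ρg ih with hasUpperCover? g
    ... | no none with other-cover ρg
    ...   | d , dg , d≢ρ = record
      { in-block = Xg , ε ; c⋖e = ρg ; d⋖e = dg ; d≢c = d≢ρ ; reach = ε ; good = maximal⇒good none
      ; leaf = λ { (_ , ε) _ → refl ; (_ , (_ , m , Xm , gm , _) ◅ _) _ → contradiction (m , Xm , gm) none } }
    tip {ρ} {g} Xg ρg ih | yes up with ih up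
    ... | e , e≢g , g~e , good with leave (≢-sym e≢g) (conn-sym g~e)
    ...   | f , (e≢f , m , Xm , em , fm) , f~g
      with proximity em fm e≢f (≤-trans (s≤s (rk>0 ρ)) (≤-reflexive (trans (sym (proj₂ ρg)) (conn⇒rk≡ g~e))))
    ...     | c , ce , cf with other-cover ce
    ...       | d , de , d≢c = record
      { in-block = link⇒∈ (link-sym e~f) , g~e ; c⋖e = ce ; d⋖e = de ; d≢c = d≢c
      ; reach = conn-sym (lift f∈ (within-block-avoiding (proj₂ (proj₁ f∈)) f~g) cf ρg)
      ; good = good ; leaf = leaf }
      where
      e~f : Link X e f
      e~f = e≢f , m , Xm , em , fm
      f∈ : Block g f × f ≢ e
      f∈ = (link⇒∈ e~f , g~e ◅◅ e~f ◅ ε) , ≢-sym e≢f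
      leaf : ∀ {h} → Block g h → d ⋖ h → h ≡ e
      leaf {h} (Xh , g~h) dh with h ≟ e
      ... | yes eq = eq
      -- Since `e` is good, a walk from `e` to `h` must leave through `f`; lowered by one rank, it
      -- would join `c` to `d` without using `e`.
      ... | no h≢e with leave h≢e (conn-sym g~e ◅◅ g~h)
      ...   | f′ , (e≢f′ , m′ , Xm′ , em′ , f′m′) , f′~h
        with good Xm Xm′ (proj₁ em) (proj₁ em′) (trans (proj₂ em) (sym (proj₂ em′)))
      ...     | refl with only-other-cover fm f′m′ em (≢-sym e≢f) (≢-sym e≢f′)
      ...       | refl = contradiction
        (conn-mono proj₂ (lift f∈ (within-block-avoiding (proj₂ (proj₁ f∈)) f′~h) cf dh))
        (bridge ce de (≢-sym d≢c))

    tip-connected : ∀ {ρ g} (t : Tip ρ g) → Conn X ρ (Tip.d t)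
    tip-connected t = conn-mono (proj₁ ∘ proj₁) reach ◅◅ hop (proj₁ in-block) c⋖e d⋖e
      where open Tip t

    -- Such a walk avoids the whole block, hence `e`; with `reach` it would join the two ends of `e`
    -- while bypassing `e`.
    tip-fresh : ∀ {ρ g} (t : Tip ρ g) → ¬ Conn (Outside g) ρ (Tip.d t)
    tip-fresh t ρ~d = bridge c⋖e d⋖e (≢-sym d≢c) (conn-sym (conn-mono proj₂ reach)
      ◅◅ conn-mono (λ { (_ , g≁e) refl → g≁e (proj₂ in-block) }) ρ~d)
      where open Tip t

    -- The next block g′ hangs off d, the tip of the block of g: a walk leaving ρ outside the block of g
    -- that used an edge of the block of g′ would lead on to d and, with the tip, close a cycle.
    walk-outside-next : ∀ {ρ g g′ x y} (t : Tip ρ g) → X g′ → ¬ Conn X g g′ → Tip.d t ⋖ g′ →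
      Conn (Outside g) ρ x → Conn (Outside g) x y → Conn (Outside g′) x y
    walk-outside-next t Xg′ g≁g′ dg′ ρ~x ε = ε
    walk-outside-next {g = g} {g′} {x} t Xg′ g≁g′ dg′ ρ~x (l@(ne , h , (Xh , g≁h) , xh , yh) ◅ s) =
      (ne , h , (Xh , g′≁h) , xh , yh) ◅ walk-outside-next t Xg′ g≁g′ dg′ (ρ~x ◅◅ l ◅ ε) s
      where
      open Tip t
      g′≁h : ¬ Conn X g′ h
      g′≁h g′~h = bridge c⋖e d⋖e (≢-sym d≢c)
        ( conn-sym (conn-mono proj₂ reach)
        ◅◅ conn-mono (λ { (_ , g≁e) refl → g≁e (proj₂ in-block) }) ρ~x
        ◅◅ conn-mono (λ { (_ , g′~e) refl → g≁g′ (proj₂ in-block ◅◅ conn-sym g′~e) })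
             (conn-sym (lift (Xg′ , ε) (within-block ε g′~h) dg′ xh)))

    -- Moving through successive blocks; the tips visited so far are joined to ρ outside the current block,
    -- so no tip recurs.
    search : ∀ k {ρ g} visited → Unique visited → n < length visited + k →
      (∀ {h} → rk h ≡ rk g → X h → HasUpperCover h → GoodNear h) →
      X g → ρ ⋖ g → ρ ∈ visited → All (Conn (Outside g) ρ) visited →
      ∃ λ v → v ∉ visited × Conn X ρ v × Good X v
    search zero visited u bound ih Xg ρg ρ∈ joined =
      contradiction (<-≤-trans bound (≤-trans (≤-reflexive (ℕ.+-identityʳ _)) (unique⇒length≤ u))) (<-irrefl refl)
    search (suc k) {ρ} {g} visited u bound ih Xg ρg ρ∈ joined with tip Xg ρg (ih refl Xg)
    ... | t with any? (λ g′ → X? g′ ×-dec Tip.d t ⋖? g′ ×-dec ¬? (g′ ≟ Tip.e t))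
    ...   | no none = d , tip-fresh t ∘ All.lookup joined , tip-connected t , d-good
      where
      open Tip t
      -- No other edge meets `d`, so whatever lies strictly above `d` lies above the good element
      -- `e`.
      via-e : ∀ {x} → X x → d ⊑ x → d ≢ x → e ⊑ x
      via-e Xx dx d≢x with upper-cover dx d≢x
      ... | z , dz , zx with z ≟ e
      ...   | yes refl = zx
      ...   | no  z≢e  = contradiction (z , down Xx zx , dz , z≢e) none
      d-good : Good X d
      d-good {x} {y} Xx Xy dx dy eq with d ≟ x | d ≟ y
      ... | yes refl | _        = ⊑-rk≡⇒≡ dy eq
      ... | no _     | yes refl = sym (⊑-rk≡⇒≡ dx (sym eq))
      ... | no d≢x   | no d≢y   = good Xx Xy (via-e Xx dx d≢x) (via-e Xy dy d≢y) eq
    ...   | yes (g′ , Xg′ , dg′ , g′≢e) = found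
      where
      open Tip t
      g≁g′ : ¬ Conn X g g′
      g≁g′ g~g′ = g′≢e (leaf (Xg′ , g~g′) dg′)
      outside-next : ∀ {h} → Block g h → Outside g′ h
      outside-next (Xh , g~h) = Xh , λ g′~h → g≁g′ (g~h ◅◅ conn-sym g′~h)
      -- The new start is joined to the old one through the block of `g`, which shares no edge with
      -- the block of `g′`.
      d~ρ : Conn (Outside g′) d ρ
      d~ρ = hop (outside-next in-block) d⋖e c⋖e ◅◅ conn-sym (conn-mono (outside-next ∘ proj₁) reach)
      rk-g′ : rk g′ ≡ rk g
      rk-g′ = trans (proj₂ dg′) (trans (sym (proj₂ d⋖e)) (sym (conn⇒rk≡ (proj₂ in-block))))
      found : ∃ λ v → v ∉ visited × Conn X ρ v × Good X v
      found with search k (d ∷ visited) (unique-∷ (tip-fresh t ∘ All.lookup joined) u) (subst (n <_) (+-suc (length visited) k) bound)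
        (λ eq → ih (trans eq rk-g′)) Xg′ dg′ (here refl)
        (ε ∷ All.map (λ ρ~y → d~ρ ◅◅ walk-outside-next t Xg′ g≁g′ dg′ ε ρ~y) joined)
      ... | v , v∉ , d~v , v-good = v , v∉ ∘ there , tip-connected t ◅◅ d~v , v-good

    -- Descending induction on the rank, with `k` exceeding the distance to the height; the
    -- hypothesis one rank up feeds `search`.
    goodNear : ∀ k {u} → proj₁ height < rk u + k → X u → HasUpperCover u → GoodNear u
    goodNear zero {u} bound Xu _ = contradiction (≤-trans bound (≤-trans (≤-reflexive (ℕ.+-identityʳ _))
      (proj₁ (proj₂ height) u tt))) (<-irrefl refl)
    goodNear (suc k) {u} bound Xu (g , Xg , ug)
      -- Counting `u` as visited makes the vertex found differ from `u`.
      with search n [ u ] ([] ∷ []) ≤-refl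
        (λ {h} eq → goodNear k (subst (proj₁ height <_)
          (trans (+-suc (rk u) k) (cong (_+ k) (sym (trans eq (proj₂ ug))))) bound))
        Xg ug (here refl) (ε ∷ [])
    ... | v , v∉ , u~v , good = v , (λ { refl → v∉ (here refl) }) , u~v , good

    -- A minimal `u` below `x` is good if it has no upper cover in `X`; otherwise its component
    -- contains a good vertex, of rank 1 like `u`.
    survivor⇒good : ∀ {x} → X x → ∃ λ v → X v × Minimal P Full v × Good X v
    survivor⇒good {x} Xx with minimal-below (rk x) ≤-refl
      where
      minimal-below : ∀ r {x} → rk x ≤ r → ∃ λ u → Minimal P Full u × u ⊑ x
      minimal-below zero    {x} le = contradiction (≤-trans (rk>0 x) le) (λ ())
      minimal-below (suc r) {x} le with minimal-or-lower-cover x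
      ... | inj₁ m = x , m , ⊑-refl
      ... | inj₂ (z , zx) with minimal-below r (ℕ.≤-pred (subst (_≤ suc r) (proj₂ zx) le))
      ...   | u , mu , uz = u , mu , ⊑-trans uz (proj₁ zx)
    ... | u , mu , ux with hasUpperCover? u
    ...   | no none = u , down Xx ux , mu , maximal⇒good none
    ...   | yes up with goodNear (suc (proj₁ height)) (ℕ.m≤n+m (suc (proj₁ height)) (rk u)) (down Xx ux) up
    ...     | v , v≢u , ε , good = contradiction refl v≢u
    ...     | v , _ , u~v@(_ ◅ _) , good =
      v , conn-∈ (down Xx ux) u~v , rk≡1⇒minimal (trans (sym (conn⇒rk≡ u~v)) (minimal⇒rk≡1 mu)) , good
      where
      conn-∈ : ∀ {x y} → X x → Conn X x y → X y
      conn-∈ Xx ε       = Xx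
      conn-∈ Xx (l ◅ s) = conn-∈ (link⇒∈ l) s

  -- Good minimal elements are prepended until nothing survives; `ws` has no repetition, so the
  -- bound on its length ends the recursion.
  eliminate : ∀ k ws → Unique ws → n < length ws + k → All (Minimal P Full) ws → Eliminable ws →
    ∃ λ vs → IsOrdering (Minimal P Full) vs × Eliminable vs
  eliminate zero ws u bound = contradiction
    (<-≤-trans bound (≤-trans (≤-reflexive (ℕ.+-identityʳ _)) (unique⇒length≤ u))) (<-irrefl refl)
  eliminate (suc k) ws u bound min el with any? (survives? ws)
  ... | yes (x , Sx) with survivor⇒good (survives? ws) (survives-down ws) Sx
  ...   | v , Sv , mv , good = eliminate k (v ∷ ws) (unique-∷ (λ v∈ → All.lookup Sv v∈ ⊑-refl) u)
    (subst (n <_) (+-suc (length ws) k) bound) (mv ∷ min) ((mv , good) ∷ el)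
  eliminate (suc k) ws u bound min el | no none = ws , (u , λ x → mk⇔ (All.lookup min) (exhausted x)) , el
    where
    exhausted : ∀ x → Minimal P Full x → x ∈ ws
    exhausted x (_ , m) with x ∈? ws
    ... | yes x∈ = x∈
    -- A minimal `x` outside `ws` would survive, as an element of `ws` below `x` would equal `x`.
    ... | no  x∉ = contradiction (x , All.tabulate λ {w} w∈ wx → x∉ (subst (_∈ ws) (m w tt wx) w∈)) none

theorem7p8 : ∀ {n} (P : FinPoset n) (rk : Fin n → ℕ) (ℓ : ℕ) →
    IsLRVine P Full rk → Dim P Full ℓ →
    ((G : LGraph n) → IsOmega P Full rk G →
    (vs : List (Fin n)) → IsMATPEO G vs → IsSamplingOrder P Full rk vs)
    × Σ (List (Fin n)) (IsSamplingOrder P Full rk)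
theorem7p8 {n} P rk _ lr _ =
    (λ G omega vs peo → eliminable⇒sampling (peo⇒ordering G omega peo) (peo⇒eliminable G omega [] vs peo))
  , let vs , ord , el = eliminate (suc n) [] [] ≤-refl [] [] in vs , eliminable⇒sampling ord el
  where open LRVine P rk lr
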